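{- For every $K>0$ there is a constant $D>0$ such that for every nonempty finite set $A\subset\mathbb{R}$: if $|A(A+A+A+A)|\le K|A|^2$, then $|A+A|\le D|A|^{3/2}$.
   Context: $A+A=\{a+b:a,b\in A\}$ and $A(A+A+A+A)=\{a(b+c+d+e): a,b,c,d,e\in A\}$. -}

module Defs where

open import Data.Nat as ℕ using (ℕ; zero; suc)
open import Data.List using (List; []; _∷_; length; concatMap; map; deduplicate)
open import Data.List.Relation.Unary.Unique.Propositional using (Unique)
open import Data.Product using (Σ; ∃; _×_; _,_)
open import Relation.Binary.PropositionalEquality using (_≡_; _≢_)
open import Relation.Binary.Definitions using (DecidableEquality)
open import Relation.Binary.Structures using (IsTotalOrder)
open import Algebra.Structures using (IsCommutativeRing)

-- Axiomatization of the real numbers as a complete ordered field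
-- (categorical: every model is isomorphic to ℝ).  Equality is decidable
-- (true classically for ℝ), which is needed to count elements of finite sets.
record RealField : Set₁ where
  infixl 6 _+_
  infixl 7 _*_
  infix 4 _≤_ _<_
  field
    Carrier : Set
    _+_ _*_ : Carrier → Carrier → Carrier
    -_ : Carrier → Carrier
    0# 1# : Carrier
    _≤_ : Carrier → Carrier → Set
    _≟_ : DecidableEquality Carrier
    isCommutativeRing : IsCommutativeRing _≡_ _+_ _*_ -_ 0# 1#
    0≢1 : 0# ≢ 1#
    inverse : ∀ x → x ≢ 0# → Σ Carrier λ y → x * y ≡ 1#
    isTotalOrder : IsTotalOrder _≡_ _≤_
    +-mono-≤ : ∀ {x y} z → x ≤ y → x + z ≤ y + z
    *-nonneg : ∀ {x y} → 0# ≤ x → 0# ≤ y → 0# ≤ x * y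
    sup : (P : Carrier → Set) → Σ Carrier P →
          Σ Carrier (λ b → ∀ x → P x → x ≤ b) →
          Σ Carrier (λ s → (∀ x → P x → x ≤ s) ×
                           (∀ b → (∀ x → P x → x ≤ b) → s ≤ b))

  _<_ : Carrier → Carrier → Set
  x < y = (x ≤ y) × (x ≢ y)

  fromℕ : ℕ → Carrier
  fromℕ zero = 0#
  fromℕ (suc n) = 1# + fromℕ n

  -- finite sets are duplicate-free lists; cardinality of a set described
  -- by a list (possibly with repetitions) = number of distinct entries
  card : List Carrier → ℕ
  card xs = length (deduplicate _≟_ xs)

  _⊕_ : List Carrier → List Carrier → List Carrier
  X ⊕ Y = concatMap (λ x → map (x +_) Y) X

  sumset : List Carrier → List Carrier
  sumset A = A ⊕ A

  prodQuadSum : List Carrier → List Carrier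
  prodQuadSum A = concatMap (λ a → map (a *_) (A ⊕ (A ⊕ (A ⊕ A)))) A

{-# OPTIONS --safe #-}
module Submission where

-- Let S = A + A and Y = A(S + S) = A(A+A+A+A).  Every line y = a(x + b) with a ∈ A, a ≠ 0 and
-- b ∈ S maps S into Y monotonically.  Sort S and Y: along one line the ranks in Y of the images of
-- S are monotone and at most |Y|, so at least half of the |S| − 1 consecutive pairs of S have
-- images whose ranks differ by at most t = 2|Y|/(|S| − 1).  A pair of consecutive elements of S
-- together with its two images determines the line, so each consecutive pair is short for at most
-- |Y| t lines.  Counting (line, short pair) twice gives |A||S|² = O(|Y|²), hence |S|² = O(K² |A|³)
-- when |Y| ≤ K|A|².

open import Defs
open import Algebra.Bundles using (CommutativeRing)
import Algebra.Properties.CommutativeSemigroup as CommutativeSemigroup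
import Algebra.Properties.Ring as RingProperties
open import Data.Bool using (true; false)
open import Data.Fin using (zero; suc)
open import Data.Fin.Properties using (injective⇒≤)
open import Data.List
  using (List; []; _∷_; _++_; length; map; filter; lookup; upTo; cartesianProduct; deduplicate)
open import Data.List.Properties
  using (length-upTo; length-++; length-map; filter-accept; filter-reject; filter-notAll)
open import Data.List.Membership.Propositional using (_∈_; lose; find)
open import Data.List.Membership.Propositional.Properties
  using (∈-lookup; ∈-map⁺; ∈-map⁻; ∈-++⁺ˡ; ∈-++⁺ʳ; ∈-filter⁺; ∈-filter⁻; ∈-upTo⁺;
         ∈-concatMap⁺; ∈-concatMap⁻; ∈-cartesianProduct⁺; ∈-cartesianProduct⁻;
         ∈-deduplicate⁺; ∈-deduplicate⁻)
open import Data.List.Membership.Setoid.Properties using (index-injective)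
open import Data.List.Relation.Binary.Permutation.Propositional using (_↭_; ↭-sym; ↭⇒↭ₛ)
open import Data.List.Relation.Binary.Permutation.Propositional.Properties using (↭-length; ∈-resp-↭)
import Data.List.Relation.Binary.Permutation.Setoid.Properties as Permutationₛ
open import Data.List.Relation.Unary.All as All using (All; []; _∷_)
open import Data.List.Relation.Unary.AllPairs as AllPairs using (AllPairs; []; _∷_)
open import Data.List.Relation.Unary.Any as Any using (here; there)
import Data.List.Relation.Unary.Sorted.TotalOrder.Properties as Sorted
open import Data.List.Relation.Unary.Unique.DecPropositional.Properties using (deduplicate-!)
open import Data.List.Relation.Unary.Unique.Propositional using (Unique)
import Data.List.Relation.Unary.Unique.Propositional.Properties as Unique
import Data.List.Sort as Sort
open import Data.Nat as ℕ using (ℕ; zero; suc; z≤n; s≤s; _^_)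
open import Data.Nat.DivMod using (_/_; _%_; m/n*n≤m; m%n<n; m≡m%n+[m/n]*n)
open import Data.Nat.ListAction using (sum)
import Data.Nat.Properties as ℕ
open import Data.Nat.Tactic.RingSolver using (solve-∀)
open import Data.Product using (Σ; _×_; _,_; proj₁; proj₂)
open import Data.Sum using (_⊎_; inj₁; inj₂)
open import Function using (_∘_; id)
open import Relation.Binary.Bundles using (TotalOrder; DecTotalOrder)
import Relation.Binary.Construct.NonStrictToStrict as ToStrict
open import Relation.Binary.Definitions using (Tri; tri<; tri≈; tri>)
import Relation.Binary.Properties.TotalOrder as TotalOrderProperties
open import Relation.Binary.PropositionalEquality
  using (_≡_; _≢_; refl; sym; trans; cong; cong₂; subst; subst₂; setoid; module ≡-Reasoning)
open import Relation.Nullary using (Dec; ¬_; yes; no; contradiction; does)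
open import Relation.Unary using (Decidable)

-- Counting in finite lists: injections and double counting.

module +-CS = CommutativeSemigroup ℕ.+-commutativeSemigroup

module _ {A B : Set} where

  lookup-injective : {xs : List A} → Unique xs → ∀ i j → lookup xs i ≡ lookup xs j → i ≡ j
  lookup-injective (_ ∷ _)    zero    zero    _  = refl
  lookup-injective (x∉ ∷ _)   zero    (suc j) eq = contradiction eq (All.lookup x∉ (∈-lookup j))
  lookup-injective (x∉ ∷ _)   (suc i) zero    eq = contradiction (sym eq) (All.lookup x∉ (∈-lookup i))
  lookup-injective (_ ∷ xs!)  (suc i) (suc j) eq = cong suc (lookup-injective xs! i j eq)

  -- Sending the position of `x` in `xs` to the position of `f x` in `ys` is an injection of finite
  -- index types, because equal positions carry equal values.
  injectiveOn⇒length≤ : {xs : List A} {ys : List B} → Unique xs → (f : A → B) →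
    (∀ {x} → x ∈ xs → f x ∈ ys) →
    (∀ {x x′} → x ∈ xs → x′ ∈ xs → f x ≡ f x′ → x ≡ x′) →
    length xs ℕ.≤ length ys
  injectiveOn⇒length≤ xs! f f∈ f-inj = injective⇒≤ λ {i} {j} eq →
    lookup-injective xs! i j
      (f-inj (∈-lookup i) (∈-lookup j)
        (index-injective (setoid B) (f∈ (∈-lookup i)) (f∈ (∈-lookup j)) eq))

  length-cartesianProduct : (xs : List A) (ys : List B) →
    length (cartesianProduct xs ys) ≡ length xs ℕ.* length ys
  length-cartesianProduct []       ys = refl
  length-cartesianProduct (x ∷ xs) ys = trans (length-++ (map (x ,_) ys))
    (cong₂ ℕ._+_ (length-map (x ,_) ys) (length-cartesianProduct xs ys))

  module _ {R : A → B → Set} (R? : ∀ x → Decidable (R x)) where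

    private
      sum-filter-[] : ∀ ys → sum (map (λ y → length (filter (λ x → R? x y) [])) ys) ≡ 0
      sum-filter-[] []       = refl
      sum-filter-[] (_ ∷ ys) = sum-filter-[] ys

      sum-filter-∷ : ∀ x xs ys →
        length (filter (R? x) ys) ℕ.+ sum (map (λ y → length (filter (λ x → R? x y) xs)) ys)
        ≡ sum (map (λ y → length (filter (λ x → R? x y) (x ∷ xs))) ys)
      sum-filter-∷ x xs [] = refl
      sum-filter-∷ x xs (y ∷ ys) with does (R? x y)
      ... | true  = cong suc (trans (+-CS.x∙yz≈y∙xz l m _) (cong (m ℕ.+_) (sum-filter-∷ x xs ys)))
        where l = length (filter (R? x) ys)
              m = length (filter (λ x → R? x y) xs)
      ... | false = trans (+-CS.x∙yz≈y∙xz l m _) (cong (m ℕ.+_) (sum-filter-∷ x xs ys))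
        where l = length (filter (R? x) ys)
              m = length (filter (λ x → R? x y) xs)

    -- Both sides count the related pairs, by rows and by columns. The induction peels off one row
    -- `x`, which adds 1 to the column count of each `y` with `R x y`.
    double-counting : ∀ xs ys →
      sum (map (λ x → length (filter (R? x) ys)) xs)
      ≡ sum (map (λ y → length (filter (λ x → R? x y) xs)) ys)
    double-counting [] ys = sym (sum-filter-[] ys)
    double-counting (x ∷ xs) ys =
      trans (cong (length (filter (R? x) ys) ℕ.+_) (double-counting xs ys)) (sum-filter-∷ x xs ys)

-- Consecutive pairs and short rises.

module _ {A : Set} where

  sum-map-≤ : ∀ {f : A → ℕ} {k} xs → (∀ {x} → x ∈ xs → f x ℕ.≤ k) → sum (map f xs) ℕ.≤ length xs ℕ.* k
  sum-map-≤ []       _  = z≤n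
  sum-map-≤ (x ∷ xs) f≤ = ℕ.+-mono-≤ (f≤ (here refl)) (sum-map-≤ xs (f≤ ∘ there))

  -- The factor 2 expresses "at least half of `k`" without division.
  sum-map-≥ : ∀ {f : A → ℕ} {k} xs → (∀ {x} → x ∈ xs → k ℕ.≤ 2 ℕ.* f x) →
    length xs ℕ.* k ℕ.≤ 2 ℕ.* sum (map f xs)
  sum-map-≥ []       _  = z≤n
  sum-map-≥ {f} {k} (x ∷ xs) f≥ = ℕ.≤-trans
    (ℕ.+-mono-≤ (f≥ (here refl)) (sum-map-≥ xs (f≥ ∘ there)))
    (ℕ.≤-reflexive (sym (ℕ.*-distribˡ-+ 2 (f x) _)))

  segments : List A → List (A × A)
  segments []           = []
  segments (_ ∷ [])     = []
  segments (x ∷ y ∷ xs) = (x , y) ∷ segments (y ∷ xs)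

  length-segments : ∀ xs → length (segments xs) ≡ ℕ.pred (length xs)
  length-segments []           = refl
  length-segments (_ ∷ [])     = refl
  length-segments (_ ∷ y ∷ xs) = cong suc (length-segments (y ∷ xs))

  segments⊆ : ∀ {x y : A} zs → (x , y) ∈ segments zs → x ∈ zs × y ∈ zs
  segments⊆ (_ ∷ _ ∷ _)  (here refl) = here refl , there (here refl)
  segments⊆ (_ ∷ z ∷ zs) (there p) with x∈ , y∈ ← segments⊆ (z ∷ zs) p = there x∈ , there y∈

  module _ (g : A → ℕ) (t : ℕ) where

    -- Stated additively, so that no truncated subtraction enters.
    Short : A × A → Set
    Short (x , y) = g y ℕ.≤ t ℕ.+ g x

    short? : Decidable Short
    short? (x , y) = g y ℕ.≤? t ℕ.+ g x

    -- Each segment that is not short raises g by at least suc t, and g stays below M.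
    segments-short : ∀ {M} x xs →
      All (λ (y , z) → g y ℕ.< g z) (segments (x ∷ xs)) → All (λ y → g y ℕ.≤ M) (x ∷ xs) →
      length (segments (x ∷ xs)) ℕ.* suc t ℕ.+ g x
        ℕ.≤ M ℕ.+ length (filter short? (segments (x ∷ xs))) ℕ.* suc t
    segments-short {M} x [] _ (gx≤M ∷ []) = ℕ.≤-trans gx≤M (ℕ.m≤m+n M 0)
    segments-short {M} x (y ∷ xs) (gx<gy ∷ inc) (_ ∷ g≤M) with short? (x , y) | segments-short y xs inc g≤M
    -- A short segment is credited with `suc t` on the right, so `g x < g y` suffices here. The
    -- summand `g x` on the left is the height already reached; it makes the bound telescope.
    ... | yes short | ih = begin
      suc L ℕ.* suc t ℕ.+ g x         ≤⟨ ℕ.+-monoʳ-≤ (suc L ℕ.* suc t) (ℕ.<⇒≤ gx<gy) ⟩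
      suc L ℕ.* suc t ℕ.+ g y         ≡⟨ ℕ.+-assoc (suc t) _ _ ⟩
      suc t ℕ.+ (L ℕ.* suc t ℕ.+ g y) ≤⟨ ℕ.+-monoʳ-≤ (suc t) ih ⟩
      suc t ℕ.+ (M ℕ.+ S ℕ.* suc t)   ≡⟨ +-CS.x∙yz≈y∙xz (suc t) M _ ⟩
      M ℕ.+ suc S ℕ.* suc t
        ≡⟨ cong (λ zs → M ℕ.+ length zs ℕ.* suc t) (filter-accept short? short) ⟨
      M ℕ.+ length (filter short? (segments (x ∷ y ∷ xs))) ℕ.* suc t ∎
      where
      open ℕ.≤-Reasoning
      L = length (segments (y ∷ xs))
      S = length (filter short? (segments (y ∷ xs)))
    ... | no ¬short | ih = begin
      suc L ℕ.* suc t ℕ.+ g x         ≡⟨ shift (suc t) (L ℕ.* suc t) (g x) ⟩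
      L ℕ.* suc t ℕ.+ (suc t ℕ.+ g x) ≤⟨ ℕ.+-monoʳ-≤ (L ℕ.* suc t) (ℕ.≰⇒> ¬short) ⟩
      L ℕ.* suc t ℕ.+ g y             ≤⟨ ih ⟩
      M ℕ.+ length (filter short? (segments (y ∷ xs))) ℕ.* suc t
        ≡⟨ cong (λ zs → M ℕ.+ length zs ℕ.* suc t) (filter-reject short? ¬short) ⟨
      M ℕ.+ length (filter short? (segments (x ∷ y ∷ xs))) ℕ.* suc t ∎
      where
      open ℕ.≤-Reasoning
      L = length (segments (y ∷ xs))
      shift : ∀ a b c → (a ℕ.+ b) ℕ.+ c ≡ b ℕ.+ (a ℕ.+ c)
      shift = solve-∀

  -- The long segments rise by at least `suc t` each and by at most `M` in total. As `M` is at most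
  -- half of `suc t` times the number of segments, at most half of them are long.
  half-short : ∀ (g : A → ℕ) t {M} xs →
    All (λ (y , z) → g y ℕ.< g z) (segments xs) → All (λ y → g y ℕ.≤ M) xs →
    2 ℕ.* M ℕ.≤ length (segments xs) ℕ.* suc t →
    length (segments xs) ℕ.≤ 2 ℕ.* length (filter (short? g t) (segments xs))
  half-short g t [] _ _ _ = z≤n
  half-short g t {M} (x ∷ xs) inc g≤M 2M≤ =
    ℕ.*-cancelʳ-≤ L (2 ℕ.* S) (suc t) (ℕ.+-cancelˡ-≤ (L ℕ.* suc t) _ _ (begin
      L ℕ.* suc t ℕ.+ L ℕ.* suc t       ≡⟨ double (L ℕ.* suc t) ⟩
      2 ℕ.* (L ℕ.* suc t)
        ≤⟨ ℕ.*-monoʳ-≤ 2 (ℕ.m+n≤o⇒m≤o (L ℕ.* suc t) (segments-short g t x xs inc g≤M)) ⟩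
      2 ℕ.* (M ℕ.+ S ℕ.* suc t)         ≡⟨ distrib M S (suc t) ⟩
      2 ℕ.* M ℕ.+ 2 ℕ.* S ℕ.* suc t     ≤⟨ ℕ.+-monoˡ-≤ (2 ℕ.* S ℕ.* suc t) 2M≤ ⟩
      L ℕ.* suc t ℕ.+ 2 ℕ.* S ℕ.* suc t ∎))
    where
    open ℕ.≤-Reasoning
    L = length (segments (x ∷ xs))
    S = length (filter (short? g t) (segments (x ∷ xs)))
    double : ∀ a → a ℕ.+ a ≡ 2 ℕ.* a
    double = solve-∀
    distrib : ∀ a b c → 2 ℕ.* (a ℕ.+ b ℕ.* c) ≡ 2 ℕ.* a ℕ.+ 2 ℕ.* b ℕ.* c
    distrib = solve-∀

-- Incidences of lines and short segments; merging the two signs of slope.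

module _ {Λ A : Set} (g : Λ → A → ℕ) (M : ℕ) {ls : List Λ} (xs : List A) (ls! : Unique ls)
  (g<M : ∀ {l x} → l ∈ ls → x ∈ xs → g l x ℕ.< M)
  (g-inc : ∀ {l} → l ∈ ls → All (λ (x , y) → g l x ℕ.< g l y) (segments xs))
  (determined : ∀ {x y l l′} → (x , y) ∈ segments xs → l ∈ ls → l′ ∈ ls →
    g l x ≡ g l′ x → g l y ≡ g l′ y → l ≡ l′)
  where

  -- A line is encoded by its height at the left end and its gap over the segment. Both heights can
  -- be read back from this code, so `determined` makes it injective, and it takes at most `M * t`
  -- values.
  lines-through-short-segment : ∀ t {s} → s ∈ segments xs →
    length (filter (λ l → short? (g l) t s) ls) ℕ.≤ M ℕ.* t
  lines-through-short-segment t {x , y} s∈ = ℕ.≤-trans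
    (injectiveOn⇒length≤ (Unique.filter⁺ short ls!) code code∈ code-inj)
    (ℕ.≤-reflexive (trans (length-cartesianProduct (upTo M) (upTo t))
      (cong₂ ℕ._*_ (length-upTo M) (length-upTo t))))
    where
    short = λ l → short? (g l) t (x , y)

    -- The gap is at least 1 and at most t, so it is recorded minus 1, as a number below t.
    code : Λ → ℕ × ℕ
    code l = g l x , g l y ℕ.∸ suc (g l x)

    gap : ∀ {l} → l ∈ ls → g l y ≡ suc (g l x) ℕ.+ (g l y ℕ.∸ suc (g l x))
    gap l∈ = sym (ℕ.m+[n∸m]≡n (All.lookup (g-inc l∈) s∈))

    code∈ : ∀ {l} → l ∈ filter short ls → code l ∈ cartesianProduct (upTo M) (upTo t)
    code∈ {l} l∈f with l∈ , gy≤ ← ∈-filter⁻ short {xs = ls} l∈f = ∈-cartesianProduct⁺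
      (∈-upTo⁺ (g<M l∈ (proj₁ (segments⊆ xs s∈))))
      (∈-upTo⁺ (ℕ.+-cancelˡ-≤ (g l x) _ _ (begin
        g l x ℕ.+ suc (g l y ℕ.∸ suc (g l x)) ≡⟨ ℕ.+-suc (g l x) _ ⟩
        suc (g l x) ℕ.+ (g l y ℕ.∸ suc (g l x)) ≡⟨ gap l∈ ⟨
        g l y ≤⟨ gy≤ ⟩
        t ℕ.+ g l x ≡⟨ ℕ.+-comm t _ ⟩
        g l x ℕ.+ t ∎)))
      where open ℕ.≤-Reasoning

    code-inj : ∀ {l l′} → l ∈ filter short ls → l′ ∈ filter short ls → code l ≡ code l′ → l ≡ l′
    code-inj l∈f l′∈f eq = determined s∈ l∈ l′∈ gx≡
      (trans (gap l∈) (trans (cong₂ (λ a b → suc a ℕ.+ b) gx≡ (cong proj₂ eq)) (sym (gap l′∈))))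
      where
      l∈  = proj₁ (∈-filter⁻ short {xs = ls} l∈f)
      l′∈ = proj₁ (∈-filter⁻ short {xs = ls} l′∈f)
      gx≡ = cong proj₁ eq

  -- With `n` segments, each line is short on at least `n / 2` of them, and each segment is short
  -- for at most `M * t` lines. Counting the short pairs both ways bounds lines times `n` by
  -- `2 * n * M * t`, and `t * n ≤ 2 * M` finishes.
  lines*segments≤ : length ls ℕ.* length (segments xs) ℕ.≤ 4 ℕ.* (M ℕ.* M)
  lines*segments≤ = bound (length (segments xs)) refl
    where
    open ℕ.≤-Reasoning
    bound : ∀ n → length (segments xs) ≡ n → length ls ℕ.* n ℕ.≤ 4 ℕ.* (M ℕ.* M)
    -- Without segments there is nothing to divide by, so this case precedes the choice of `t`.
    bound zero    _     = ℕ.≤-trans (ℕ.≤-reflexive (ℕ.*-zeroʳ (length ls))) z≤n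
    -- The extra factor `n` lets `t * n ≤ 2 * M` eliminate the quotient.
    bound n@(suc _) len≡n = ℕ.*-cancelʳ-≤ _ _ n (begin
      length ls ℕ.* n ℕ.* n ≤⟨ ℕ.*-monoˡ-≤ n (begin
        length ls ℕ.* n ≤⟨ sum-map-≥ ls many-short ⟩
        2 ℕ.* sum (map (λ l → length (filter (short? (g l) t) segs)) ls)
          ≡⟨ cong (2 ℕ.*_) (double-counting (λ l → short? (g l) t) ls segs) ⟩
        2 ℕ.* sum (map (λ s → length (filter (λ l → short? (g l) t s) ls)) segs)
          ≤⟨ ℕ.*-monoʳ-≤ 2 (sum-map-≤ segs (lines-through-short-segment t)) ⟩
        2 ℕ.* (length segs ℕ.* (M ℕ.* t)) ≡⟨ cong (λ k → 2 ℕ.* (k ℕ.* (M ℕ.* t))) len≡n ⟩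
        2 ℕ.* (n ℕ.* (M ℕ.* t)) ∎) ⟩
      2 ℕ.* (n ℕ.* (M ℕ.* t)) ℕ.* n ≡⟨ regroup n M t ⟩
      2 ℕ.* n ℕ.* M ℕ.* (t ℕ.* n)   ≤⟨ ℕ.*-monoʳ-≤ (2 ℕ.* n ℕ.* M) (m/n*n≤m (2 ℕ.* M) n) ⟩
      2 ℕ.* n ℕ.* M ℕ.* (2 ℕ.* M)   ≡⟨ collect n M ⟩
      4 ℕ.* (M ℕ.* M) ℕ.* n         ∎)
      where
      segs = segments xs
      -- Rounding down serves both needs: `t * n ≤ 2 * M` for the final bound, and
      -- `2 * M ≤ n * suc t` for `half-short`.
      t = 2 ℕ.* M / n
      regroup : ∀ n M t → 2 ℕ.* (n ℕ.* (M ℕ.* t)) ℕ.* n ≡ 2 ℕ.* n ℕ.* M ℕ.* (t ℕ.* n)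
      regroup = solve-∀
      collect : ∀ n M → 2 ℕ.* n ℕ.* M ℕ.* (2 ℕ.* M) ≡ 4 ℕ.* (M ℕ.* M) ℕ.* n
      collect = solve-∀

      2M≤ : 2 ℕ.* M ℕ.≤ n ℕ.* suc t
      2M≤ = begin
        2 ℕ.* M                     ≡⟨ m≡m%n+[m/n]*n (2 ℕ.* M) n ⟩
        2 ℕ.* M % n ℕ.+ t ℕ.* n     ≤⟨ ℕ.+-monoˡ-≤ (t ℕ.* n) (ℕ.<⇒≤ (m%n<n (2 ℕ.* M) n)) ⟩
        n ℕ.+ t ℕ.* n               ≡⟨ ℕ.*-comm (suc t) n ⟩
        n ℕ.* suc t                 ∎

      many-short : ∀ {l} → l ∈ ls → n ℕ.≤ 2 ℕ.* length (filter (short? (g l) t) segs)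
      many-short {l} l∈ = subst (ℕ._≤ 2 ℕ.* length (filter (short? (g l) t) segs)) len≡n
        (half-short (g l) t xs (g-inc l∈) (All.tabulate (ℕ.<⇒≤ ∘ g<M l∈))
          (subst (λ k → 2 ℕ.* M ℕ.≤ k ℕ.* suc t) (sym len≡n) 2M≤))

-- Here `p` and `q` count the positive and negative slopes. From `2 ≤ n` follows `1 ≤ p + q`, so
-- `n ≤ 2 * (p + q)`; likewise `N ≤ 2 * pred N` once `N` is at least 2. For `N ≤ 1` the factor
-- `pred N` vanishes and the bounds say nothing, hence the alternative.
combine-signs : ∀ n p q N M → 2 ℕ.≤ n → n ℕ.≤ suc (p ℕ.+ q) →
  p ℕ.* N ℕ.* ℕ.pred N ℕ.≤ 4 ℕ.* (M ℕ.* M) → q ℕ.* N ℕ.* ℕ.pred N ℕ.≤ 4 ℕ.* (M ℕ.* M) →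
  N ℕ.≤ 1 ⊎ n ℕ.* N ^ 2 ℕ.≤ 36 ℕ.* (M ℕ.* M)
combine-signs n p q zero          M _ _ _ _ = inj₁ z≤n
combine-signs n p q (suc zero)    M _ _ _ _ = inj₁ (s≤s z≤n)
combine-signs n p q N@(suc N′@(suc N″)) M 2≤n n≤ p≤ q≤ = inj₂ (begin
  -- `N ^ 2` computes to `N * (N * 1)`, whence the factor 1 in `expand`.
  n ℕ.* N ^ 2                                          ≤⟨ ℕ.*-mono-≤ n≤2[p+q] (ℕ.*-monoʳ-≤ N (ℕ.*-monoˡ-≤ 1 N≤2N′)) ⟩
  2 ℕ.* (p ℕ.+ q) ℕ.* (N ℕ.* (2 ℕ.* N′ ℕ.* 1))         ≡⟨ expand p q N N′ ⟩
  4 ℕ.* (p ℕ.* N ℕ.* N′ ℕ.+ q ℕ.* N ℕ.* N′)            ≤⟨ ℕ.*-monoʳ-≤ 4 (ℕ.+-mono-≤ p≤ q≤) ⟩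
  4 ℕ.* (4 ℕ.* (M ℕ.* M) ℕ.+ 4 ℕ.* (M ℕ.* M))          ≡⟨ collect (M ℕ.* M) ⟩
  -- 36 is the next perfect square; its root 6 reappears in the final constant.
  32 ℕ.* (M ℕ.* M)                                     ≤⟨ ℕ.*-monoˡ-≤ (M ℕ.* M) (ℕ.m≤m+n 32 4) ⟩
  36 ℕ.* (M ℕ.* M)                                     ∎)
  where
  open ℕ.≤-Reasoning
  expand : ∀ p q N N′ → 2 ℕ.* (p ℕ.+ q) ℕ.* (N ℕ.* (2 ℕ.* N′ ℕ.* 1)) ≡
    4 ℕ.* (p ℕ.* N ℕ.* N′ ℕ.+ q ℕ.* N ℕ.* N′)
  expand = solve-∀
  collect : ∀ m → 4 ℕ.* (4 ℕ.* m ℕ.+ 4 ℕ.* m) ≡ 32 ℕ.* m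
  collect = solve-∀
  1+k≤2k : ∀ {k} → 1 ℕ.≤ k → suc k ℕ.≤ 2 ℕ.* k
  1+k≤2k {k} 1≤k = ℕ.≤-trans (ℕ.+-monoˡ-≤ k 1≤k) (ℕ.+-monoʳ-≤ k (ℕ.m≤m+n k 0))
  n≤2[p+q] : n ℕ.≤ 2 ℕ.* (p ℕ.+ q)
  n≤2[p+q] = ℕ.≤-trans n≤ (1+k≤2k (ℕ.s≤s⁻¹ (ℕ.≤-trans 2≤n n≤)))
  N≤2N′ : N ℕ.≤ 2 ℕ.* N′
  N≤2N′ = 1+k≤2k (s≤s z≤n)

-- Arithmetic of the ordered field and the embedding of ℕ.

module _ (ℝ : RealField) where
  open RealField ℝ

  commutativeRing : CommutativeRing _ _
  commutativeRing = record { isCommutativeRing = isCommutativeRing }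

  open CommutativeRing commutativeRing
    using (ring; +-comm; +-assoc; +-identityˡ; +-identityʳ; -‿inverseʳ; -‿inverseˡ;
           *-comm; *-assoc; *-identityˡ; zeroˡ; distribʳ; _-_)
  open RingProperties ring
    using (+-cancelˡ; +-cancelʳ; -0#≈0#; -‿injective; -‿involutive; -‿+-comm;
           -‿distribˡ-*; -‿distribʳ-*; x[y-z]≈xy-xz; x∙y⁻¹≈ε⇒x≈y)

  totalOrder : TotalOrder _ _ _
  totalOrder = record { isTotalOrder = isTotalOrder }

  open TotalOrder totalOrder using (total; antisym; isPartialOrder)
    renaming (refl to ≤-refl; trans to ≤-trans; reflexive to ≤-reflexive)

  decTotalOrder : DecTotalOrder _ _ _
  decTotalOrder = TotalOrderProperties.decTotalOrder totalOrder _≟_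

  open DecTotalOrder decTotalOrder using (_≤?_)

  infix 4 _<?_
  _<?_ : ∀ x y → Dec (x < y)
  _<?_ = ToStrict.<-decidable _≡_ _≤_ _≟_ _≤?_

  compare : ∀ x y → Tri (x < y) (x ≡ y) (y < x)
  compare = ToStrict.<-trichotomous _≡_ _≤_ sym _≟_ antisym total

  <-irrefl : ∀ {x} → ¬ (x < x)
  <-irrefl (_ , x≢x) = x≢x refl

  <-trans : ∀ {x y z} → x < y → y < z → x < z
  <-trans = ToStrict.<-trans _≡_ _≤_ isPartialOrder

  x-y+y≡x : ∀ x y → (x - y) + y ≡ x
  x-y+y≡x x y = trans (+-assoc x (- y) y) (trans (cong (x +_) (-‿inverseˡ y)) (+-identityʳ x))

  x+y-y≡x : ∀ x y → (x + y) - y ≡ x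
  x+y-y≡x x y = trans (+-assoc x y (- y)) (trans (cong (x +_) (-‿inverseʳ y)) (+-identityʳ x))

  x≤y⇒0≤y-x : ∀ {x y} → x ≤ y → 0# ≤ y - x
  x≤y⇒0≤y-x {x} {y} x≤y = subst (_≤ y - x) (-‿inverseʳ x) (+-mono-≤ (- x) x≤y)

  0≤y-x⇒x≤y : ∀ {x y} → 0# ≤ y - x → x ≤ y
  0≤y-x⇒x≤y {x} {y} 0≤y-x = subst₂ _≤_ (+-identityˡ x) (x-y+y≡x y x) (+-mono-≤ x 0≤y-x)

  +-monoʳ-≤ : ∀ z {x y} → x ≤ y → z + x ≤ z + y
  +-monoʳ-≤ z {x} {y} x≤y = subst₂ _≤_ (+-comm x z) (+-comm y z) (+-mono-≤ z x≤y)

  *-monoˡ-≤ : ∀ {a} → 0# ≤ a → ∀ {x y} → x ≤ y → a * x ≤ a * y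
  *-monoˡ-≤ {a} 0≤a {x} {y} x≤y =
    0≤y-x⇒x≤y (subst (0# ≤_) (x[y-z]≈xy-xz a y x) (*-nonneg 0≤a (x≤y⇒0≤y-x x≤y)))

  *-mono-≤ : ∀ {x y u v} → 0# ≤ x → 0# ≤ v → x ≤ y → u ≤ v → x * u ≤ y * v
  *-mono-≤ {x} {y} {u} {v} 0≤x 0≤v x≤y u≤v = ≤-trans (*-monoˡ-≤ 0≤x u≤v)
    (subst₂ _≤_ (*-comm v x) (*-comm v y) (*-monoˡ-≤ 0≤v x≤y))

  *-cancelˡ : ∀ {a} → a ≢ 0# → ∀ {x y} → a * x ≡ a * y → x ≡ y
  *-cancelˡ {a} a≢0 {x} {y} ax≡ay with a⁻¹ , aa⁻¹≡1 ← inverse a a≢0 =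
    trans (sym (undo x)) (trans (cong (a⁻¹ *_) ax≡ay) (undo y))
    where
    undo : ∀ z → a⁻¹ * (a * z) ≡ z
    undo z = trans (sym (*-assoc a⁻¹ a z))
      (trans (cong (_* z) (trans (*-comm a⁻¹ a) aa⁻¹≡1)) (*-identityˡ z))

  *-cancelˡ-≤ : ∀ {a} → 0# < a → ∀ {x y} → a * x ≤ a * y → x ≤ y
  *-cancelˡ-≤ (0≤a , 0≢a) {x} {y} ax≤ay with total x y
  ... | inj₁ x≤y = x≤y
  ... | inj₂ y≤x = ≤-reflexive (*-cancelˡ (0≢a ∘ sym) (antisym ax≤ay (*-monoˡ-≤ 0≤a y≤x)))

  +-monoˡ-< : ∀ z {x y} → x < y → x + z < y + z
  +-monoˡ-< z (x≤y , x≢y) = +-mono-≤ z x≤y , x≢y ∘ +-cancelʳ z _ _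

  *-monoʳ-< : ∀ {a} → 0# < a → ∀ {x y} → x < y → a * x < a * y
  *-monoʳ-< (0≤a , 0≢a) (x≤y , x≢y) = *-monoˡ-≤ 0≤a x≤y , x≢y ∘ *-cancelˡ (0≢a ∘ sym)

  x<0⇒0<-x : ∀ {x} → x < 0# → 0# < - x
  x<0⇒0<-x {x} (x≤0 , x≢0) =
    subst (0# ≤_) (+-identityˡ (- x)) (x≤y⇒0≤y-x x≤0) ,
    λ 0≡-x → x≢0 (-‿injective (trans (sym 0≡-x) (sym -0#≈0#)))

  -x*-y≡x*y : ∀ x y → - x * - y ≡ x * y
  -x*-y≡x*y x y = trans (sym (-‿distribˡ-* x (- y)))
    (trans (cong -_ (sym (-‿distribʳ-* x y))) (-‿involutive (x * y)))

  0≤1 : 0# ≤ 1#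
  0≤1 with total 0# 1#
  ... | inj₁ 0≤1 = 0≤1
  -- If 1 were at most 0, then -1 would be nonnegative, and so would its square 1.
  ... | inj₂ 1≤0 = subst (0# ≤_) (trans (-x*-y≡x*y 1# 1#) (*-identityˡ 1#)) (*-nonneg 0≤-1 0≤-1)
    where
    0≤-1 : 0# ≤ - 1#
    0≤-1 = subst (0# ≤_) (+-identityˡ (- 1#)) (x≤y⇒0≤y-x 1≤0)

  0≤x⇒y≤x+y : ∀ {x y} → 0# ≤ x → y ≤ x + y
  0≤x⇒y≤x+y {x} {y} 0≤x = subst (_≤ x + y) (+-identityˡ y) (+-mono-≤ y 0≤x)

  0≤y⇒x≤x+y : ∀ {x y} → 0# ≤ y → x ≤ x + y
  0≤y⇒x≤x+y {x} {y} 0≤y = subst (_≤ x + y) (+-identityʳ x) (+-monoʳ-≤ x 0≤y)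

  1≤x⇒0<x : ∀ {x} → 1# ≤ x → 0# < x
  1≤x⇒0<x 1≤x = ≤-trans 0≤1 1≤x , λ 0≡x → 0≢1 (antisym 0≤1 (subst (1# ≤_) (sym 0≡x) 1≤x))

  0≤fromℕ : ∀ n → 0# ≤ fromℕ n
  0≤fromℕ zero    = ≤-refl
  0≤fromℕ (suc n) = ≤-trans (0≤fromℕ n) (0≤x⇒y≤x+y 0≤1)

  fromℕ-mono-≤ : ∀ {m n} → m ℕ.≤ n → fromℕ m ≤ fromℕ n
  fromℕ-mono-≤ {n = n} z≤n = 0≤fromℕ n
  fromℕ-mono-≤ (s≤s m≤n)   = +-monoʳ-≤ 1# (fromℕ-mono-≤ m≤n)

  fromℕ-+ : ∀ m n → fromℕ (m ℕ.+ n) ≡ fromℕ m + fromℕ n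
  fromℕ-+ zero    n = sym (+-identityˡ (fromℕ n))
  fromℕ-+ (suc m) n = trans (cong (1# +_) (fromℕ-+ m n)) (sym (+-assoc 1# (fromℕ m) (fromℕ n)))

  fromℕ-* : ∀ m n → fromℕ (m ℕ.* n) ≡ fromℕ m * fromℕ n
  fromℕ-* zero    n = sym (zeroˡ (fromℕ n))
  fromℕ-* (suc m) n = trans (fromℕ-+ n (m ℕ.* n))
    (trans (cong₂ _+_ (sym (*-identityˡ (fromℕ n))) (fromℕ-* m n)) (sym (distribʳ (fromℕ n) 1# (fromℕ m))))

  0<fromℕ-suc : ∀ n → 0# < fromℕ (suc n)
  0<fromℕ-suc n = 1≤x⇒0<x (0≤y⇒x≤x+y (0≤fromℕ n))

  -- Sorting, ranks, and the lines over the sorted set.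

  sorted : ∀ S → Unique S → Σ (List Carrier) λ T → AllPairs _<_ T × T ↭ S
  sorted S S! = sort S ,
    -- `x < y` is by definition `x ≤ y` paired with `x ≢ y`, so sortedness and distinctness zip to
    -- strict order.
    AllPairs.zip (Sorted.Sorted⇒AllPairs totalOrder (sort-↗ S) ,
                  Permutationₛ.Unique-resp-↭ (setoid Carrier) (↭⇒↭ₛ (↭-sym (sort-↭ S))) S!) ,
    sort-↭ S
    where open Sort decTotalOrder

  segments-sorted : ∀ {T} → AllPairs _<_ T → ∀ {x y} → (x , y) ∈ segments T → x < y
  segments-sorted {_ ∷ _ ∷ _} ((x<y ∷ _) ∷ _) (here refl) = x<y
  segments-sorted {_ ∷ _ ∷ _} (_ ∷ T<)        (there p)   = segments-sorted T< p

  module _ {Y : List Carrier} (Y! : Unique Y) where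

    -- Ranks replace real heights by natural numbers below `length Y`, so that rises can be counted.
    rank : Carrier → ℕ
    rank y = length (filter (_<? y) Y)

    -- Everything below `y` is below `z`, and `y` itself is counted only for `z`.
    rank-mono : ∀ {y z} → y ∈ Y → y < z → rank y ℕ.< rank z
    rank-mono {y} {z} y∈Y y<z = injectiveOn⇒length≤ (y∉ ∷ Unique.filter⁺ (_<? y) Y!) id below (λ _ _ eq → eq)
      where
      y∉ : All (y ≢_) (filter (_<? y) Y)
      y∉ = All.tabulate λ x∈ y≡x → proj₂ (proj₂ (∈-filter⁻ (_<? y) {xs = Y} x∈)) (sym y≡x)

      below : ∀ {x} → x ∈ y ∷ filter (_<? y) Y → x ∈ filter (_<? z) Y
      below (here refl) = ∈-filter⁺ (_<? z) y∈Y y<z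
      below (there x∈) with x∈Y , x<y ← ∈-filter⁻ (_<? y) {xs = Y} x∈ = ∈-filter⁺ (_<? z) x∈Y (<-trans x<y y<z)

    rank-bound : ∀ {y} → y ∈ Y → rank y ℕ.< length Y
    rank-bound {y} y∈Y = filter-notAll (_<? y) Y (lose y∈Y <-irrefl)

    rank-injective : ∀ {y z} → y ∈ Y → z ∈ Y → rank y ≡ rank z → y ≡ z
    rank-injective {y} {z} y∈Y z∈Y eq with compare y z
    ... | tri< y<z _ _ = contradiction eq (ℕ.<⇒≢ (rank-mono y∈Y y<z))
    ... | tri≈ _ y≡z _ = y≡z
    ... | tri> _ _ z<y = contradiction (sym eq) (ℕ.<⇒≢ (rank-mono z∈Y z<y))

    -- The pair (a , b) stands for the line y = a (x + b).
    positive-expansion : ∀ {P S} → Unique P → Unique S → (∀ {a} → a ∈ P → 0# < a) →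
      (∀ {a b c} → a ∈ P → b ∈ S → c ∈ S → a * (c + b) ∈ Y) →
      length P ℕ.* length S ℕ.* ℕ.pred (length S) ℕ.≤ 4 ℕ.* (length Y ℕ.* length Y)
    positive-expansion {P} {S} P! S! P>0 ∈Y with T , T< , T↭S ← sorted S S! =
      subst (ℕ._≤ 4 ℕ.* (length Y ℕ.* length Y))
        (cong₂ ℕ._*_ (length-cartesianProduct P S)
          (trans (length-segments T) (cong ℕ.pred (↭-length T↭S))))
        (lines*segments≤ height (length Y) T (Unique.cartesianProduct⁺ P! S!)
          (λ l∈ x∈ → rank-bound (point∈Y l∈ x∈))
          (λ l∈ → All.tabulate λ s∈ → rank-mono (point∈Y l∈ (proj₁ (segments⊆ T s∈))) (increasing l∈ s∈))
          determined)
      where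
      at : Carrier × Carrier → Carrier → Carrier
      at (a , b) x = a * (x + b)

      height : Carrier × Carrier → Carrier → ℕ
      height l x = rank (at l x)

      point∈Y : ∀ {l x} → l ∈ cartesianProduct P S → x ∈ T → at l x ∈ Y
      point∈Y l∈ x∈ with a∈ , b∈ ← ∈-cartesianProduct⁻ P S l∈ = ∈Y a∈ b∈ (∈-resp-↭ T↭S x∈)

      increasing : ∀ {l x y} → l ∈ cartesianProduct P S → (x , y) ∈ segments T → at l x < at l y
      increasing {_ , b} l∈ s∈ =
        *-monoʳ-< (P>0 (proj₁ (∈-cartesianProduct⁻ P S l∈))) (+-monoˡ-< b (segments-sorted T< s∈))

      -- The rise over a segment does not depend on `b`, so the heights at both ends reveal the
      -- slope.
      rise : ∀ a b x y → at (a , b) y - at (a , b) x ≡ (y - x) * a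
      rise a b x y = begin
        a * (y + b) - a * (x + b) ≡⟨ x[y-z]≈xy-xz a (y + b) (x + b) ⟨
        a * ((y + b) - (x + b))   ≡⟨ cong (λ z → a * ((y + b) + z)) (-‿+-comm x b) ⟨
        a * ((y + b) + (- x + - b)) ≡⟨ cong (λ z → a * ((y + b) + z)) (+-comm (- x) (- b)) ⟩
        a * ((y + b) + (- b + - x)) ≡⟨ cong (a *_) (+-assoc (y + b) (- b) (- x)) ⟨
        a * (((y + b) - b) - x)   ≡⟨ cong (λ z → a * (z - x)) (x+y-y≡x y b) ⟩
        a * (y - x)               ≡⟨ *-comm a (y - x) ⟩
        (y - x) * a               ∎
        where open ≡-Reasoning

      determined : ∀ {x y l l′} → (x , y) ∈ segments T →
        l ∈ cartesianProduct P S → l′ ∈ cartesianProduct P S →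
        height l x ≡ height l′ x → height l y ≡ height l′ y → l ≡ l′
      determined {x} {y} {a , b} {a′ , b′} s∈ l∈ l′∈ eqx eqy = cong₂ _,_ a≡a′ b≡b′
        where
        x∈ = proj₁ (segments⊆ T s∈)
        y∈ = proj₂ (segments⊆ T s∈)
        atx≡ : at (a , b) x ≡ at (a′ , b′) x
        atx≡ = rank-injective (point∈Y l∈ x∈) (point∈Y l′∈ x∈) eqx
        aty≡ : at (a , b) y ≡ at (a′ , b′) y
        aty≡ = rank-injective (point∈Y l∈ y∈) (point∈Y l′∈ y∈) eqy

        a≡a′ : a ≡ a′
        a≡a′ = *-cancelˡ (λ y-x≡0 → proj₂ (segments-sorted T< s∈) (sym (x∙y⁻¹≈ε⇒x≈y y x y-x≡0)))
          (trans (sym (rise a b x y)) (trans (cong₂ _-_ aty≡ atx≡) (rise a′ b′ x y)))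

        b≡b′ : b ≡ b′
        -- With equal nonzero slopes, equal heights at `x` force equal shifts.
        b≡b′ = +-cancelˡ x b b′ (*-cancelˡ (proj₂ (P>0 (proj₁ (∈-cartesianProduct⁻ P S l∈))) ∘ sym)
          (trans atx≡ (cong (_* (x + b′)) (sym a≡a′))))

    -- Negating both `P` and `S` makes the slopes positive and preserves every product
    -- `a * (c + b)`, so the same `Y` serves.
    negative-expansion : ∀ {P S} → Unique P → Unique S → (∀ {a} → a ∈ P → a < 0#) →
      (∀ {a b c} → a ∈ P → b ∈ S → c ∈ S → a * (c + b) ∈ Y) →
      length P ℕ.* length S ℕ.* ℕ.pred (length S) ℕ.≤ 4 ℕ.* (length Y ℕ.* length Y)
    negative-expansion {P} {S} P! S! P<0 ∈Y =
      subst₂ (λ p s → p ℕ.* s ℕ.* ℕ.pred s ℕ.≤ 4 ℕ.* (length Y ℕ.* length Y)) (length-map -_ P) (length-map -_ S)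
        (positive-expansion (Unique.map⁺ -‿injective P!) (Unique.map⁺ -‿injective S!) P>0 -∈Y)
      where
      P>0 : ∀ {a} → a ∈ map -_ P → 0# < a
      P>0 a∈ with _ , a∈P , refl ← ∈-map⁻ -_ a∈ = x<0⇒0<-x (P<0 a∈P)

      -∈Y : ∀ {a b c} → a ∈ map -_ P → b ∈ map -_ S → c ∈ map -_ S → a * (c + b) ∈ Y
      -∈Y a∈ b∈ c∈
        with a , a∈P , refl ← ∈-map⁻ -_ a∈ | b , b∈S , refl ← ∈-map⁻ -_ b∈ | c , c∈S , refl ← ∈-map⁻ -_ c∈ =
        subst (_∈ Y) (sym (trans (cong (- a *_) (-‿+-comm c b)) (-x*-y≡x*y a (c + b)))) (∈Y a∈P b∈S c∈S)

  -- Sumset membership and the expansion inequality.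

  ∈-⊕⁺ : ∀ {X Y x y} → x ∈ X → y ∈ Y → x + y ∈ X ⊕ Y
  ∈-⊕⁺ {x = x} x∈X y∈Y = ∈-concatMap⁺ _ (Any.map (λ { refl → ∈-map⁺ (x +_) y∈Y }) x∈X)

  ∈-⊕⁻ : ∀ X Y {z} → z ∈ X ⊕ Y → Σ Carrier λ x → Σ Carrier λ y → x ∈ X × y ∈ Y × z ≡ x + y
  ∈-⊕⁻ X Y z∈ with x , x∈X , z∈x+Y ← find (∈-concatMap⁻ (λ x → map (x +_) Y) {xs = X} z∈)
    with y , y∈Y , z≡x+y ← ∈-map⁻ (x +_) z∈x+Y = x , y , x∈X , y∈Y , z≡x+y

  -- Only `c` has to be split: reassociating `(c₁ + c₂) + b` matches the right-nested fourfold sum,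
  -- whose last two summands form `b`.
  ∈-prodQuadSum⁺ : ∀ A {a b c} → a ∈ A → b ∈ sumset A → c ∈ sumset A → a * (c + b) ∈ prodQuadSum A
  ∈-prodQuadSum⁺ A {a} {b} a∈ b∈ c∈
    with c₁ , c₂ , c₁∈ , c₂∈ , refl ← ∈-⊕⁻ A A c∈ =
    ∈-concatMap⁺ _ (Any.map (λ { refl → ∈-map⁺ (a *_) (subst (_∈ A ⊕ (A ⊕ (A ⊕ A))) (sym (+-assoc c₁ c₂ b))
      (∈-⊕⁺ c₁∈ (∈-⊕⁺ c₂∈ b∈))) }) a∈)

  -- The suc accounts for a possible zero of A.
  length-by-sign : ∀ {A} → Unique A →
    length A ℕ.≤ suc (length (filter (0# <?_) A) ℕ.+ length (filter (_<? 0#) A))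
  length-by-sign {A} A! = subst (length A ℕ.≤_) (cong suc (length-++ (filter (0# <?_) A)))
    (injectiveOn⇒length≤ A! id sign (λ _ _ eq → eq))
    where
    sign : ∀ {x} → x ∈ A → x ∈ 0# ∷ filter (0# <?_) A ++ filter (_<? 0#) A
    sign {x} x∈ with compare 0# x
    ... | tri< 0<x _ _ = there (∈-++⁺ˡ (∈-filter⁺ (0# <?_) x∈ 0<x))
    ... | tri≈ _ 0≡x _ = here (sym 0≡x)
    ... | tri> _ _ x<0 = there (∈-++⁺ʳ _ (∈-filter⁺ (_<? 0#) x∈ x<0))

  expansion-2≤ : ∀ A → Unique A → 2 ℕ.≤ length A → card (sumset A) ℕ.≤ 1 ⊎
    length A ℕ.* card (sumset A) ^ 2 ℕ.≤ 36 ℕ.* (card (prodQuadSum A) ℕ.* card (prodQuadSum A))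
  expansion-2≤ A A! 2≤n = combine-signs (length A) (length P) (length Q) (length S) (length Y)
    2≤n (length-by-sign A!)
    (positive-expansion Y! (Unique.filter⁺ (0# <?_) A!) S! (proj₂ ∘ ∈-filter⁻ (0# <?_) {xs = A})
      (∈Y ∘ proj₁ ∘ ∈-filter⁻ (0# <?_) {xs = A}))
    (negative-expansion Y! (Unique.filter⁺ (_<? 0#) A!) S! (proj₂ ∘ ∈-filter⁻ (_<? 0#) {xs = A})
      (∈Y ∘ proj₁ ∘ ∈-filter⁻ (_<? 0#) {xs = A}))
    where
    P  = filter (0# <?_) A
    Q  = filter (_<? 0#) A
    -- The lengths of the deduplicated lists are the values of `card` by definition.
    S  = deduplicate _≟_ (sumset A)
    Y  = deduplicate _≟_ (prodQuadSum A)
    S! = deduplicate-! _≟_ (sumset A)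
    Y! = deduplicate-! _≟_ (prodQuadSum A)

    ∈Y : ∀ {a b c} → a ∈ A → b ∈ S → c ∈ S → a * (c + b) ∈ Y
    ∈Y a∈ b∈ c∈ = ∈-deduplicate⁺ _≟_
      (∈-prodQuadSum⁺ A a∈ (∈-deduplicate⁻ _≟_ (sumset A) b∈) (∈-deduplicate⁻ _≟_ (sumset A) c∈))

  expansion : ∀ A → Unique A → card (sumset A) ℕ.≤ 1 ⊎
    length A ℕ.* card (sumset A) ^ 2 ℕ.≤ 36 ℕ.* (card (prodQuadSum A) ℕ.* card (prodQuadSum A))
  expansion []              _  = inj₁ z≤n
  -- The sumset of a singleton computes to a list with one entry.
  expansion (_ ∷ [])        _  = inj₁ (s≤s z≤n)
  expansion A@(_ ∷ _ ∷ _)   A! = expansion-2≤ A A! (s≤s (s≤s z≤n))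

  -- From the counting inequality to the constant `D`.

  sumset²≤D²n³ : ∀ {K D} n N M → 0# ≤ K → 1# ≤ D → fromℕ 6 * K ≤ D → 1 ℕ.≤ n →
    N ℕ.≤ 1 ⊎ n ℕ.* N ^ 2 ℕ.≤ 36 ℕ.* (M ℕ.* M) →
    fromℕ M ≤ K * fromℕ (n ^ 2) → fromℕ (N ^ 2) ≤ (D * D) * fromℕ (n ^ 3)
  -- The degenerate case: `N ^ 2 ≤ 1`, while `D * D` and `n ^ 3` are at least 1.
  sumset²≤D²n³ {K} {D} n N M 0≤K 1≤D 6K≤D 1≤n (inj₁ N≤1) _ = ≤-trans
    (fromℕ-mono-≤ {n = 1} (ℕ.^-monoˡ-≤ 2 N≤1))
    (≤-trans (≤-reflexive 1≡1*1*1) (*-mono-≤ (*-nonneg 0≤1 0≤1) (0≤fromℕ (n ^ 3))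
      (*-mono-≤ 0≤1 (≤-trans 0≤1 1≤D) 1≤D 1≤D)
      (fromℕ-mono-≤ (ℕ.^-monoˡ-≤ 3 1≤n))))
    where
    1≡1*1*1 : fromℕ 1 ≡ 1# * 1# * fromℕ 1
    1≡1*1*1 = sym (trans (cong (_* fromℕ 1) (*-identityˡ 1#)) (*-identityˡ (fromℕ 1)))
  -- The chain is `n N² ≤ (6M)² ≤ (D n²)² = n (D² n³)`, using `6M ≤ 6K n² ≤ D n²`; then the positive
  -- factor `n` cancels.
  sumset²≤D²n³ {K} {D} n@(suc n-1) N M 0≤K 1≤D 6K≤D _ (inj₂ nN²≤36M²) M≤Kn² =
    *-cancelˡ-≤ (0<fromℕ-suc n-1)
      (subst₂ _≤_ (fromℕ-* n (N ^ 2)) squares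
        (≤-trans (fromℕ-mono-≤ nN²≤36M²)
          (≤-trans (≤-reflexive (trans (cong fromℕ (square M)) (fromℕ-* (6 ℕ.* M) (6 ℕ.* M))))
            (*-mono-≤ (0≤fromℕ (6 ℕ.* M)) 0≤Dn² 6M≤Dn² 6M≤Dn²))))
    where
    n² n³ : Carrier
    n² = fromℕ (n ^ 2)
    n³ = fromℕ (n ^ 3)

    0≤Dn² : 0# ≤ D * n²
    0≤Dn² = *-nonneg (≤-trans 0≤1 1≤D) (0≤fromℕ (n ^ 2))

    6M≤Dn² : fromℕ (6 ℕ.* M) ≤ D * n²
    6M≤Dn² = ≤-trans (≤-reflexive (fromℕ-* 6 M)) (≤-trans (*-monoˡ-≤ (0≤fromℕ 6) M≤Kn²)
      (≤-trans (≤-reflexive (sym (*-assoc (fromℕ 6) K n²)))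
        (*-mono-≤ (*-nonneg (0≤fromℕ 6) 0≤K) (0≤fromℕ (n ^ 2)) 6K≤D ≤-refl)))

    square : ∀ m → 36 ℕ.* (m ℕ.* m) ≡ 6 ℕ.* m ℕ.* (6 ℕ.* m)
    square = solve-∀

    powers : ∀ k → k ^ 2 ℕ.* k ^ 2 ≡ k ℕ.* k ^ 3
    powers k = sym (ℕ.^-distribˡ-+-* k 2 2)

    squares : (D * n²) * (D * n²) ≡ fromℕ n * ((D * D) * n³)
    squares = begin
      (D * n²) * (D * n²)       ≡⟨ *-CS.interchange D n² D n² ⟩
      (D * D) * (n² * n²)       ≡⟨ cong ((D * D) *_) (fromℕ-* (n ^ 2) (n ^ 2)) ⟨
      (D * D) * fromℕ (n ^ 2 ℕ.* n ^ 2) ≡⟨ cong (λ k → (D * D) * fromℕ k) (powers n) ⟩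
      (D * D) * fromℕ (n ℕ.* n ^ 3) ≡⟨ cong ((D * D) *_) (fromℕ-* n (n ^ 3)) ⟩
      (D * D) * (fromℕ n * n³)  ≡⟨ *-CS.x∙yz≈y∙xz (D * D) (fromℕ n) n³ ⟩
      fromℕ n * ((D * D) * n³)  ∎
      where
      open ≡-Reasoning
      module *-CS = CommutativeSemigroup (CommutativeRing.*-commutativeSemigroup commutativeRing)

-- Squaring the conclusion avoids the exponent 3/2; nothing is lost, since both sides are
-- nonnegative.
theorem9 : (ℝ : RealField) → let open RealField ℝ in
    (K : Carrier) → 0# < K →
    Σ Carrier λ D → 0# < D ×
    ((A : List Carrier) → Unique A → A ≢ [] →
    fromℕ (card (prodQuadSum A)) ≤ K * fromℕ (length A ^ 2) →
    fromℕ (card (sumset A) ^ 2) ≤ (D * D) * fromℕ (length A ^ 3))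
theorem9 ℝ K (0≤K , _) = D , 1≤x⇒0<x ℝ 1≤D , λ A A! A≢[] →
  sumset²≤D²n³ ℝ (length A) (card (sumset A)) (card (prodQuadSum A)) 0≤K 1≤D
    (0≤y⇒x≤x+y ℝ (0≤1 ℝ)) (nonempty A≢[]) (expansion ℝ A A!)
  where
  open RealField ℝ

  D : Carrier
  -- The 6 is the root of 36; the added 1 gives `1 ≤ D`, used for positivity and for the case of a
  -- sumset with at most one element.
  D = fromℕ 6 * K + 1#

  1≤D : 1# ≤ D
  1≤D = 0≤x⇒y≤x+y ℝ (*-nonneg (0≤fromℕ ℝ 6) 0≤K)

  nonempty : ∀ {A : List Carrier} → A ≢ [] → 1 ℕ.≤ length A
  nonempty {[]}    A≢[] = contradiction refl A≢[]
  nonempty {_ ∷ _} _    = s≤s z≤n
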